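{- Dekking's result yields that there exists an abelian $6$-power free morphism $h$ over the binary alphabet $\Sigma=\{a,b\}$ with a fixed point $\Omega_1'$ such that: (i) $aaaaaa$ is not a factor of $\Omega_1'$ (there are at most $5$ consecutive $a$'s in $\Omega_1'$); (ii) $bb$ is not a factor of $\Omega_1'$ (there are no two consecutive $b$'s in $\Omega_1'$); (iii) $\Omega_1'$ is abelian $6$-power free.
   Context: $\Sigma^*$ is the free monoid of finite words over $\Sigma$, with empty word $\epsilon$. A morphism $h$ over $\Sigma$ is a monoid homomorphism $h:\Sigma^*\to\Sigma^*$, extended letter by letter to infinite words; a fixed point of $h$ is an infinite word $\Omega\in\Sigma^{\mathbb{N}}$ with $h(\Omega)=\Omega$. A factor is a contiguous finite subword. The Parikh vector $\psi(u)$ of a finite word $u$ records the number of occurrences of each letter in $u$. A word $u$ (finite or infinite) is abelian $k$-power free if whenever $u=xv_1\cdots v_ky$ with $v_1,\dots,v_k$ finite words satisfying $\psi(v_1)=\cdots=\psi(v_k)$, one has $v_1=\cdots=v_k=\epsilon$. A morphism $h$ is abelian $n$-power free if $h(u)$ is abelian $n$-power free for every abelian $n$-power free word $u$. "Dekking's result", named in the claim as the tool from which the existence is obtained, is the following known sufficient criterion. Let $n>1$, let $h:\Sigma^*\to\Sigma^*$ be a morphism, $G$ a finite abelian group (written additively) and $f:\Sigma^*\to G$ a monoid morphism. Write $\operatorname{Pref}(h)$ for the set of all prefixes (including $\epsilon$ and the full word) of the words $h(\sigma)$, $\sigma\in\Sigma$, and $h(\Sigma)=\{h(\sigma):\sigma\in\Sigma\}$.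 Suppose: (D1) the frequency matrix of $h$, whose rows are the vectors $\psi(h(\sigma))$ for $\sigma\in\Sigma$, is non-singular; (D2) $f(h(\sigma))=0$ for each $\sigma\in\Sigma$; (D3) the set $f(\operatorname{Pref}(h))$ contains no arithmetic progression of length $n+1$ with non-zero common difference; (D4) for any positive integer $r$, if $f(v_1)=\cdots=f(v_r)$ with $v_i\in\operatorname{Pref}(h)\setminus h(\Sigma)$ for all $i$, then either $v_1=\cdots=v_r$ or $v_1'=\cdots=v_r'$, where $v_iv_i'=h(\sigma_{j_i})$ for some $\sigma_{j_i}\in\Sigma$. Then $h$ is an abelian $n$-power free morphism. -}

module Defs where

open import Algebra.Morphism.Bundles using (MonoidHomomorphism)
open import Data.Fin.Base using (Fin)
open import Data.List.Base
  using (List; []; _∷_; _++_; length; filter; concat; tabulate; applyUpTo; ++-[]-rawMonoid)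
open import Data.Nat.Base using (ℕ; zero; suc; _≤_)
open import Data.Product.Base using (∃-syntax; _×_)
open import Relation.Binary.Definitions using (DecidableEquality)
open import Relation.Binary.PropositionalEquality using (_≡_; _≗_; refl)
open import Relation.Nullary.Decidable.Core using (yes; no)

module Words {A : Set} (_≟_ : DecidableEquality A) where

  infixr 6 _·_
  infixr 5 _++ω_ _◁_
  infix  4 _≈_

  ψ : List A → A → ℕ
  ψ u c = length (filter (c ≟_) u)

  data Word : Set where
    fin : List A → Word
    inf : (ℕ → A) → Word

  -- Infinite words are compared letter by letter, as functions are not
  -- extensional.
  data _≈_ : Word → Word → Set where
    fin : ∀ {u v} → u ≡ v → fin u ≈ fin v
    inf : ∀ {u v} → u ≗ v → inf u ≈ inf v

  _++ω_ : List A → (ℕ → A) → (ℕ → A)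
  ([]      ++ω w) n       = w n
  ((c ∷ x) ++ω w) zero    = c
  ((c ∷ x) ++ω w) (suc n) = (x ++ω w) n

  _◁_ : List A → Word → Word
  x ◁ fin y = fin (x ++ y)
  x ◁ inf y = inf (x ++ω y)

  Prefix : List A → Word → Set
  Prefix v u = ∃[ y ] (u ≈ v ◁ y)

  Factor : List A → Word → Set
  Factor v u = ∃[ x ] ∃[ y ] (u ≈ x ◁ v ◁ y)

  AbelianPowerFree : ℕ → Word → Set
  AbelianPowerFree k u =
    (x : List A) (v : Fin k → List A) (y : Word) →
    u ≈ x ◁ concat (tabulate v) ◁ y →
    (∀ i j → ψ (v i) ≗ ψ (v j)) →
    ∀ i → v i ≡ []

  Morphism : Set
  Morphism = MonoidHomomorphism (++-[]-rawMonoid A) (++-[]-rawMonoid A)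

  _·_ : Morphism → List A → List A
  _·_ = MonoidHomomorphism.⟦_⟧

  -- Image h u v means that v is the image of u under h, extended letter by
  -- letter to infinite words: h(w₀)h(w₁)h(w₂)⋯ is infinite exactly when the
  -- lengths of the images of the prefixes of w are unbounded.  It is finite
  -- when h erases all but finitely many of the letters of w.  The extension
  -- is a relation because which case applies is not decidable in general.
  data Image (h : Morphism) : Word → Word → Set where
    fin     : ∀ {u v} → h · u ≡ v → Image h (fin u) (fin v)
    inf     : ∀ {w w′} →
              (∀ n → Prefix (h · applyUpTo w n) (inf w′)) →
              (∀ m → ∃[ n ] (m ≤ length (h · applyUpTo w n))) →
              Image h (inf w) (inf w′)
    inf→fin : ∀ {w v} →
              ∃[ m ] (∀ n → m ≤ n → h · applyUpTo w n ≡ v) →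
              Image h (inf w) (fin v)

  FixedPoint : Morphism → (ℕ → A) → Set
  FixedPoint h Ω = Image h (inf Ω) (inf Ω)

  AbelianPowerFreeMorphism : ℕ → Morphism → Set
  AbelianPowerFreeMorphism n h =
    ∀ {u v} → Image h u v → AbelianPowerFree n u → AbelianPowerFree n v

data Letter : Set where
  a b : Letter

_≟ᴸ_ : DecidableEquality Letter
a ≟ᴸ a = yes refl
a ≟ᴸ b = no λ ()
b ≟ᴸ a = no λ ()
b ≟ᴸ b = yes refl

open Words _≟ᴸ_ public

-- Give a weight 1 and b weight 2.  The images aaaaba and baaba of the letters
-- have weight 7, and both are aaba preceded by a word of weight 2.  Hence inside
-- an image of a word the weight of the part of the current image that is still
-- to come takes only the values 0, 1, 3, 4, 5, 6, and determines that part.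
-- Along an abelian 6-power these values form a progression of length 7 modulo 7
-- that avoids 2, so it is constant, and the power is a conjugate of the image of
-- words whose Parikh vectors agree because the frequency matrix has determinant 7.
module Submission where

open import Defs
open import Algebra.Morphism.Structures using (IsMonoidHomomorphism)
open import Data.Empty using (⊥-elim)
open import Data.Fin.Base using (Fin; zero; suc; toℕ; fromℕ<; inject₁)
open import Data.Fin.Induction using (<-weakInduction)
open import Data.Fin.Patterns
open import Data.Fin.Properties using (all?; any?; toℕ-fromℕ<; toℕ-inject₁) renaming (_≟_ to _≟ᶠ_)
open import Data.List.Base
  using (List; []; _∷_; _++_; length; filter; drop; concat; concatMap; tabulate; applyUpTo;
         ++-[]-rawMonoid)
open import Data.List.Properties
  using (++-assoc; ++-identityʳ; ++-cancelʳ; length-++; length-applyUpTo; filter-++;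
         concatMap-++; ∷-injective)
open import Data.Nat.Base
  using (ℕ; zero; suc; _+_; _*_; _≤_; _<_; NonZero; z≤n; s≤s; _≤′_; ≤′-refl; ≤′-step)
open import Data.Nat.DivMod using (_%_; m%n<n; m%n%n≡m%n; [m+kn]%n≡m%n; %-distribˡ-+)
open import Data.Nat.Properties
  using (_≟_; ≤-trans; ≤-total; ≤⇒≤′; m≤m+n; m≤n+m; m≤n⇒∃[o]m+o≡n; <⇒≱; n≤1+n;
         +-assoc; +-comm; +-identityʳ; +-cancelˡ-≡; +-cancelʳ-≡; *-zeroʳ; *-cancelˡ-≡)
open import Data.Nat.Tactic.RingSolver using (solve-∀)
open import Data.Product.Base using (∃-syntax; _×_; _,_)
open import Data.Sum.Base using (inj₁; inj₂)
open import Data.Vec.Functional as Vector using (Vector)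
open import Function.Base using (_∘_)
open import Relation.Binary.PropositionalEquality
open import Relation.Nullary.Decidable using (from-yes; toWitness; _→-dec_)
open import Relation.Nullary.Negation.Core using (¬_)

-- The morphism, its letter weights and its frequency matrix.

image : Letter → List Letter
image a = a ∷ a ∷ a ∷ a ∷ b ∷ a ∷ []
image b = b ∷ a ∷ a ∷ b ∷ a ∷ []

φ : List Letter → List Letter
φ = concatMap image

φ-isMonoidHomomorphism :
  IsMonoidHomomorphism (++-[]-rawMonoid Letter) (++-[]-rawMonoid Letter) φ
φ-isMonoidHomomorphism = record
  { isMagmaHomomorphism = record
    { isRelHomomorphism = record { cong = cong φ }
    ; homo = concatMap-++ image
    }
  ; ε-homo = refl
  }

φ-morphism : Morphism
φ-morphism = record { ⟦_⟧ = φ ; isMonoidHomomorphism = φ-isMonoidHomomorphism }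

ψ-++ : ∀ u v c → ψ (u ++ v) c ≡ ψ u c + ψ v c
ψ-++ u v c = trans (cong length (filter-++ (c ≟ᴸ_) u v)) (length-++ (filter (c ≟ᴸ_) u))

weight : List Letter → ℕ
weight u = ψ u a + 2 * ψ u b

weight-++ : ∀ u v → weight (u ++ v) ≡ weight u + weight v
weight-++ u v = trans (cong₂ (λ m n → m + 2 * n) (ψ-++ u v a) (ψ-++ u v b))
                      (rearrange (ψ u a) (ψ v a) (ψ u b) (ψ v b))
  where
  rearrange : ∀ m m′ n n′ → (m + m′) + 2 * (n + n′) ≡ (m + 2 * n) + (m′ + 2 * n′)
  rearrange = solve-∀

weight-φ : ∀ u → weight (φ u) ≡ length u * 7
weight-φ [] = refl
weight-φ (a ∷ u) = trans (weight-++ (image a) (φ u)) (cong (7 +_) (weight-φ u))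
weight-φ (b ∷ u) = trans (weight-++ (image b) (φ u)) (cong (7 +_) (weight-φ u))

ψ-φ-a : ∀ u → ψ (φ u) a ≡ 5 * ψ u a + 3 * ψ u b
ψ-φ-a [] = refl
ψ-φ-a (a ∷ u) = trans (ψ-++ (image a) (φ u) a)
  (trans (cong (5 +_) (ψ-φ-a u)) (rearrange (ψ u a) (ψ u b)))
  where
  rearrange : ∀ m n → 5 + (5 * m + 3 * n) ≡ 5 * (1 + m) + 3 * n
  rearrange = solve-∀
ψ-φ-a (b ∷ u) = trans (ψ-++ (image b) (φ u) a)
  (trans (cong (3 +_) (ψ-φ-a u)) (rearrange (ψ u a) (ψ u b)))
  where
  rearrange : ∀ m n → 3 + (5 * m + 3 * n) ≡ 5 * m + 3 * (1 + n)
  rearrange = solve-∀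

ψ-φ-b : ∀ u → ψ (φ u) b ≡ ψ u a + 2 * ψ u b
ψ-φ-b [] = refl
ψ-φ-b (a ∷ u) = trans (ψ-++ (image a) (φ u) b) (cong suc (ψ-φ-b u))
ψ-φ-b (b ∷ u) = trans (ψ-++ (image b) (φ u) b)
  (trans (cong (2 +_) (ψ-φ-b u)) (rearrange (ψ u a) (ψ u b)))
  where
  rearrange : ∀ m n → 2 + (m + 2 * n) ≡ m + 2 * (1 + n)
  rearrange = solve-∀

-- Each clause multiplies by one row of the adjugate of the frequency matrix, moves the negative
-- term to the other side so as to stay in `ℕ`, and cancels the determinant 7.
ψ-φ-injective : ∀ u v → ψ (φ u) ≗ ψ (φ v) → ψ u ≗ ψ v
ψ-φ-injective u v eq a = *-cancelˡ-≡ _ _ 7 (+-cancelʳ-≡ (3 * ψ (φ v) b) _ _ (begin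
  7 * ψ u a + 3 * ψ (φ v) b  ≡⟨ cong (λ n → 7 * ψ u a + 3 * n) (eq b) ⟨
  7 * ψ u a + 3 * ψ (φ u) b  ≡⟨ adjugate u ⟩
  2 * ψ (φ u) a              ≡⟨ cong (2 *_) (eq a) ⟩
  2 * ψ (φ v) a              ≡⟨ adjugate v ⟨
  7 * ψ v a + 3 * ψ (φ v) b  ∎))
  where
  open ≡-Reasoning
  rearrange : ∀ m n → 7 * m + 3 * (m + 2 * n) ≡ 2 * (5 * m + 3 * n)
  rearrange = solve-∀
  adjugate : ∀ w → 7 * ψ w a + 3 * ψ (φ w) b ≡ 2 * ψ (φ w) a
  adjugate w rewrite ψ-φ-a w | ψ-φ-b w = rearrange (ψ w a) (ψ w b)
ψ-φ-injective u v eq b = *-cancelˡ-≡ _ _ 7 (+-cancelʳ-≡ (ψ (φ v) a) _ _ (begin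
  7 * ψ u b + ψ (φ v) a  ≡⟨ cong (7 * ψ u b +_) (eq a) ⟨
  7 * ψ u b + ψ (φ u) a  ≡⟨ adjugate u ⟩
  5 * ψ (φ u) b          ≡⟨ cong (5 *_) (eq b) ⟩
  5 * ψ (φ v) b          ≡⟨ adjugate v ⟨
  7 * ψ v b + ψ (φ v) a  ∎))
  where
  open ≡-Reasoning
  rearrange : ∀ m n → 7 * n + (5 * m + 3 * n) ≡ 5 * (m + 2 * n)
  rearrange = solve-∀
  adjugate : ∀ w → 7 * ψ w b + ψ (φ w) a ≡ 5 * ψ (φ w) b
  adjugate w rewrite ψ-φ-a w | ψ-φ-b w = rearrange (ψ w a) (ψ w b)

length≤length-φ : ∀ u → length u ≤ length (φ u)
length≤length-φ [] = z≤n
length≤length-φ (a ∷ u) = s≤s (≤-trans (length≤length-φ u) (m≤n+m _ 5))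
length≤length-φ (b ∷ u) = s≤s (≤-trans (length≤length-φ u) (m≤n+m _ 4))

-- Parsing a factor of an image.

-- Both images end in aaba and are otherwise a single b or aa, so what is left
-- of an image after any nonempty prefix of it is a suffix of aaaba.
pending : Fin 6 → List Letter
pending s = drop (toℕ s) (a ∷ a ∷ a ∷ b ∷ a ∷ [])

boundary : Fin 6
boundary = 5F

-- Describes a cut of `pending s ++ φ u` between `v` and `t`. The cut may fall inside an image:
-- `pending state` is the part of that image lying beyond `v`, and its letter, if taken from `u`,
-- counts as consumed.
record Split (s : Fin 6) (u v t : List Letter) : Set where
  constructor split
  field
    state     : Fin 6
    consumed  : List Letter
    remaining : List Letter
    u-split   : u ≡ consumed ++ remaining
    v-parse   : pending s ++ φ consumed ≡ v ++ pending state
    t-parse   : t ≡ pending state ++ φ remaining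

advance : ∀ {s s′ u v t c} → pending s ≡ c ∷ pending s′ → Split s′ u v t → Split s u (c ∷ v) t
advance {s} {c = c} eq (split s″ q r p₁ p₂ p₃) =
  split s″ q r p₁ (trans (cong (_++ φ q) eq) (cong (c ∷_) p₂)) p₃

enter : ∀ {s u v t c} d → image d ≡ c ∷ pending s →
        Split s u v t → Split boundary (d ∷ u) (c ∷ v) t
enter {c = c} d eq (split s″ q r p₁ p₂ p₃) =
  split s″ (d ∷ q) r (cong (d ∷_) p₁) (trans (cong (_++ φ q) eq) (cong (c ∷_) p₂)) p₃

-- The parse is an automaton reading `v`. Only in state `boundary` does a step take a letter of `u`;
-- in every other state the pending suffix loses its head.
splitAt : ∀ s u v {t} → pending s ++ φ u ≡ v ++ t → Split s u v t
splitAt s u [] eq = split s [] u refl (++-identityʳ _) (sym eq)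
splitAt 0F u (c ∷ v) eq with refl , eq′ ← ∷-injective eq = advance refl (splitAt 1F u v eq′)
splitAt 1F u (c ∷ v) eq with refl , eq′ ← ∷-injective eq = advance refl (splitAt 2F u v eq′)
splitAt 2F u (c ∷ v) eq with refl , eq′ ← ∷-injective eq = advance refl (splitAt 3F u v eq′)
splitAt 3F u (c ∷ v) eq with refl , eq′ ← ∷-injective eq = advance refl (splitAt 4F u v eq′)
splitAt 4F u (c ∷ v) eq with refl , eq′ ← ∷-injective eq = advance refl (splitAt 5F u v eq′)
splitAt 5F (a ∷ u) (c ∷ v) eq with refl , eq′ ← ∷-injective eq = enter a refl (splitAt 0F u v eq′)
splitAt 5F (b ∷ u) (c ∷ v) eq with refl , eq′ ← ∷-injective eq = enter b refl (splitAt 1F u v eq′)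

-- The `k` blocks have `k + 1` cuts. Their states form one vector, the initial state included, so
-- that they can be treated as a single progression.
record Splits {k} (s : Fin 6) (u : List Letter) (v : Vector (List Letter) k) : Set where
  constructor splits
  field
    states    : Vector (Fin 6) (suc k)
    start     : states zero ≡ s
    consumed  : Vector (List Letter) k
    remaining : List Letter
    u-split   : u ≡ concat (tabulate consumed) ++ remaining
    v-parse   : ∀ i → pending (states (inject₁ i)) ++ φ (consumed i) ≡ v i ++ pending (states (suc i))

splitAll : ∀ {k} s u (v : Vector (List Letter) k) {t} →
           pending s ++ φ u ≡ concat (tabulate v) ++ t → Splits s u v
splitAll {zero} s u v eq = splits (λ _ → s) refl (λ ()) u refl λ ()
splitAll {suc k} s u v eq
  with split s′ q r refl p p₃ ← splitAt s u (v zero) (trans eq (++-assoc (v zero) _ _))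
  with splits ss refl qs r′ refl ps ← splitAll s′ r (v ∘ suc) (sym p₃) =
    splits (s Vector.∷ ss) refl (q Vector.∷ qs) r′ (sym (++-assoc q _ _))
           λ { zero → p ; (suc i) → ps i }

-- Residues of the cuts modulo 7.

[m%n+o]%n≡[m+o]%n : ∀ m o n .{{_ : NonZero n}} → (m % n + o) % n ≡ (m + o) % n
[m%n+o]%n≡[m+o]%n m o n = begin
  (m % n + o) % n          ≡⟨ %-distribˡ-+ (m % n) o n ⟩
  (m % n % n + o % n) % n  ≡⟨ cong (λ r → (r + o % n) % n) (m%n%n≡m%n m n) ⟩
  (m % n + o % n) % n      ≡⟨ %-distribˡ-+ m o n ⟨
  (m + o) % n              ∎
  where open ≡-Reasoning

residue : Fin 6 → ℕ
residue s = weight (pending s)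

residue-injective : ∀ s t → residue s ≡ residue t → s ≡ t
residue-injective = from-yes (all? λ s → all? λ t → (residue s ≟ residue t) →-dec (s ≟ᶠ t))

residue-% : ∀ s → residue s % 7 ≡ residue s
residue-% = from-yes (all? λ s → residue s % 7 ≟ residue s)

-- Only six of the seven classes modulo 7 are residues, whereas seven
-- consecutive terms of a nonconstant progression meet all of them.
residue-progression :
  ∀ s (d : Fin 7) → (∀ (j : Fin 7) → ∃[ t ] (residue t ≡ (residue s + toℕ j * toℕ d) % 7)) → d ≡ 0F
residue-progression = toWitness {a? = all? λ s → all? λ d →
  all? (λ j → any? λ t → residue t ≟ (residue s + toℕ j * toℕ d) % 7) →-dec (d ≟ᶠ 0F)} _

-- Images weigh 7, so reading `v` lowers the residue by `weight v` modulo 7. The factor 6 stands for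
-- -1 and avoids subtraction.
residue-step : ∀ s t v q → pending s ++ φ q ≡ v ++ pending t →
               residue t ≡ (residue s + 6 * weight v % 7) % 7
residue-step s t v q eq = begin
  residue t                                      ≡⟨ residue-% t ⟨
  residue t % 7                                  ≡⟨ [m+kn]%n≡m%n (residue t) d 7 ⟨
  (residue t + d * 7) % 7                        ≡⟨ cong (_% 7) (lhs (residue t) d) ⟩
  ((d + residue t) + 6 * d) % 7                  ≡⟨ cong (λ n → (n + 6 * d) % 7) weights ⟨
  ((residue s + length q * 7) + 6 * d) % 7       ≡⟨ cong (_% 7) (rhs (residue s) (length q) (6 * d)) ⟩
  ((6 * d + residue s) + length q * 7) % 7       ≡⟨ [m+kn]%n≡m%n (6 * d + residue s) (length q) 7 ⟩
  (6 * d + residue s) % 7                        ≡⟨ [m%n+o]%n≡[m+o]%n (6 * d) (residue s) 7 ⟨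
  (6 * d % 7 + residue s) % 7                    ≡⟨ cong (_% 7) (+-comm (6 * d % 7) (residue s)) ⟩
  (residue s + 6 * d % 7) % 7                    ∎
  where
  open ≡-Reasoning
  d = weight v
  lhs : ∀ m n → m + n * 7 ≡ (n + m) + 6 * n
  lhs = solve-∀
  rhs : ∀ m n o → (m + n * 7) + o ≡ (o + m) + n * 7
  rhs = solve-∀
  weights : residue s + length q * 7 ≡ d + residue t
  weights = begin
    residue s + length q * 7    ≡⟨ cong (residue s +_) (weight-φ q) ⟨
    residue s + weight (φ q)    ≡⟨ weight-++ (pending s) (φ q) ⟨
    weight (pending s ++ φ q)   ≡⟨ cong weight eq ⟩
    weight (v ++ pending t)     ≡⟨ weight-++ v (pending t) ⟩
    d + residue t               ∎

states-constant :
  (ss : Vector (Fin 6) 7) (e : ℕ) → e < 7 →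
  (∀ i → residue (ss (suc i)) ≡ (residue (ss (inject₁ i)) + e) % 7) →
  ∀ i → ss i ≡ ss zero
states-constant ss e e<7 step i =
  residue-injective (ss i) (ss zero) (begin
    residue (ss i)                             ≡⟨ progression i ⟩
    (residue (ss zero) + toℕ i * e) % 7        ≡⟨ cong (λ n → (residue (ss zero) + toℕ i * n) % 7) e≡0 ⟩
    (residue (ss zero) + toℕ i * 0) % 7        ≡⟨ cong (λ n → (residue (ss zero) + n) % 7) (*-zeroʳ (toℕ i)) ⟩
    (residue (ss zero) + 0) % 7                ≡⟨ cong (_% 7) (+-identityʳ (residue (ss zero))) ⟩
    residue (ss zero) % 7                      ≡⟨ residue-% (ss zero) ⟩
    residue (ss zero)                          ∎)
  where
  open ≡-Reasoning
  progression : ∀ i → residue (ss i) ≡ (residue (ss zero) + toℕ i * e) % 7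
  progression = <-weakInduction _
    (sym (trans (cong (_% 7) (+-identityʳ (residue (ss zero)))) (residue-% (ss zero))))
    λ i ih → begin
      residue (ss (suc i))                                        ≡⟨ step i ⟩
      (residue (ss (inject₁ i)) + e) % 7                          ≡⟨ cong (λ n → (n + e) % 7) ih ⟩
      ((residue (ss zero) + toℕ (inject₁ i) * e) % 7 + e) % 7     ≡⟨ [m%n+o]%n≡[m+o]%n (residue (ss zero) + toℕ (inject₁ i) * e) e 7 ⟩
      ((residue (ss zero) + toℕ (inject₁ i) * e) + e) % 7
        ≡⟨ cong (λ n → ((residue (ss zero) + n * e) + e) % 7) (toℕ-inject₁ i) ⟩
      ((residue (ss zero) + toℕ i * e) + e) % 7
        ≡⟨ cong (_% 7) (trans (+-assoc (residue (ss zero)) _ e) (cong (residue (ss zero) +_) (+-comm _ e))) ⟩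
      (residue (ss zero) + toℕ (suc i) * e) % 7                   ∎
  e≡0 : e ≡ 0
  -- The bound on `e` makes it an element of `Fin 7`, which the finite check requires; the seven
  -- cuts supply the seven terms.
  e≡0 = trans (sym (toℕ-fromℕ< e<7)) (cong toℕ (residue-progression (ss zero) (fromℕ< e<7) λ j →
    ss j , trans (progression j)
      (cong (λ n → (residue (ss zero) + toℕ j * n) % 7) (sym (toℕ-fromℕ< e<7)))))

-- Images of finite words.

φ-powerFree : ∀ {u} → AbelianPowerFree 6 (fin u) → AbelianPowerFree 6 (fin (φ u))
φ-powerFree {u} free x v (fin y) (fin eq) ψ-eq
  with split s q₀ r refl _ r-parse ← splitAt boundary u x eq
  with splits ss refl q r′ refl v-parse ← splitAll s r v (sym r-parse) =
  -- Once `q i` is empty, `parse i` equates the pending suffix with `v i` followed by that same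
  -- suffix.
  λ i → sym (++-cancelʳ (pending (ss zero)) [] (v i)
    (trans (sym (++-identityʳ _))
      (trans (cong (λ p → pending (ss zero) ++ φ p) (sym (q-empty i))) (parse i))))
  where
  d = weight (v zero)
  weight-constant : ∀ i → weight (v i) ≡ d
  weight-constant i = cong₂ (λ m n → m + 2 * n) (ψ-eq i zero a) (ψ-eq i zero b)
  constant : ∀ i → ss i ≡ ss zero
  constant = states-constant ss (6 * d % 7) (m%n<n (6 * d) 7) λ i →
    trans (residue-step (ss (inject₁ i)) (ss (suc i)) (v i) (q i) (v-parse i))
          (cong (λ n → (residue (ss (inject₁ i)) + 6 * n % 7) % 7) (weight-constant i))
  parse : ∀ i → pending (ss zero) ++ φ (q i) ≡ v i ++ pending (ss zero)
  parse i = subst₂ (λ s t → pending s ++ φ (q i) ≡ v i ++ pending t)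
                   (constant (inject₁ i)) (constant (suc i)) (v-parse i)
  -- With equal states at both ends, `parse i` makes `v i` a conjugate of `φ (q i)`, so their letter
  -- counts agree.
  ψ-φ-q : ∀ i → ψ (φ (q i)) ≗ ψ (v i)
  ψ-φ-q i c = +-cancelˡ-≡ (ψ (pending (ss zero)) c) _ _ (begin
    ψ (pending (ss zero)) c + ψ (φ (q i)) c  ≡⟨ ψ-++ (pending (ss zero)) (φ (q i)) c ⟨
    ψ (pending (ss zero) ++ φ (q i)) c       ≡⟨ cong (λ w → ψ w c) (parse i) ⟩
    ψ (v i ++ pending (ss zero)) c           ≡⟨ ψ-++ (v i) (pending (ss zero)) c ⟩
    ψ (v i) c + ψ (pending (ss zero)) c      ≡⟨ +-comm (ψ (v i) c) _ ⟩
    ψ (pending (ss zero)) c + ψ (v i) c      ∎)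
    where open ≡-Reasoning
  q-empty : ∀ i → q i ≡ []
  -- The words `q i` are consecutive in `u` and share a Parikh vector, so they form an abelian
  -- 6-power there.
  q-empty = free q₀ q (fin r′) (fin refl) λ i j → ψ-φ-injective (q i) (q j) λ c →
    trans (ψ-φ-q i c) (trans (ψ-eq i j c) (sym (ψ-φ-q j c)))

-- In both images each `b` is followed by an `a` of the same image, so in no state can the text
-- after the cut begin with `bb`.
no-bb-in-φ : ∀ u x y → ¬ φ u ≡ x ++ b ∷ b ∷ y
no-bb-in-φ u x y eq with splitAt boundary u x eq
... | split 0F _ _ _ _ ()
... | split 1F _ _ _ _ ()
... | split 2F _ _ _ _ ()
... | split 3F _ _ _ _ ()
... | split 4F _ _ _ _ ()
... | split 5F _ [] _ _ ()
... | split 5F _ (a ∷ _) _ _ ()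
... | split 5F _ (b ∷ _) _ _ ()

-- Infinite words through their finite prefixes.

++ω-++ : ∀ x y w → (x ++ y) ++ω w ≗ x ++ω y ++ω w
++ω-++ [] y w n = refl
++ω-++ (c ∷ x) y w zero = refl
++ω-++ (c ∷ x) y w (suc n) = ++ω-++ x y w n

applyUpTo-cong : ∀ {w w′ : ℕ → Letter} → w ≗ w′ → applyUpTo w ≗ applyUpTo w′
applyUpTo-cong eq zero = refl
applyUpTo-cong eq (suc n) = cong₂ _∷_ (eq 0) (applyUpTo-cong (eq ∘ suc) n)

applyUpTo-+ : ∀ (w : ℕ → Letter) m n → applyUpTo w (m + n) ≡ applyUpTo w m ++ applyUpTo (w ∘ (m +_)) n
applyUpTo-+ w zero n = refl
applyUpTo-+ w (suc m) n = cong (w 0 ∷_) (applyUpTo-+ (w ∘ suc) m n)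

applyUpTo-≤ : ∀ (w : ℕ → Letter) {m n} → m ≤ n → ∃[ r ] (applyUpTo w n ≡ applyUpTo w m ++ r)
applyUpTo-≤ w {m} m≤n with o , refl ← m≤n⇒∃[o]m+o≡n m≤n = _ , applyUpTo-+ w m o

-- Agreement is asked only below `length x` because the padding `w` is arbitrary; `applyUpTo-Ω`
-- relies on this.
applyUpTo-agree : ∀ x w (w′ : ℕ → Letter) → (∀ n → n < length x → (x ++ω w) n ≡ w′ n) →
                  applyUpTo w′ (length x) ≡ x
applyUpTo-agree [] w w′ eq = refl
applyUpTo-agree (c ∷ x) w w′ eq =
  cong₂ _∷_ (sym (eq 0 (s≤s z≤n))) (applyUpTo-agree x w (w′ ∘ suc) λ n n< → eq (suc n) (s≤s n<))

applyUpTo-++ω : ∀ {w x y} → w ≗ x ++ω y → applyUpTo w (length x) ≡ x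
applyUpTo-++ω {w} {x} {y} eq = applyUpTo-agree x y w λ n _ → sym (eq n)

applyUpTo-++ω-drop : ∀ (w : ℕ → Letter) n → w ≗ applyUpTo w n ++ω (w ∘ (n +_))
applyUpTo-++ω-drop w zero m = refl
applyUpTo-++ω-drop w (suc n) zero = refl
applyUpTo-++ω-drop w (suc n) (suc m) = applyUpTo-++ω-drop (w ∘ suc) n m

factor-of-applyUpTo : ∀ {w x v y} → inf w ≈ x ◁ v ◁ y → applyUpTo w (length (x ++ v)) ≡ x ++ v
factor-of-applyUpTo {x = x} {v} {inf y} (inf eq) =
  applyUpTo-++ω λ n → trans (eq n) (sym (++ω-++ x v y n))

powerFree-prefix : ∀ {k} u {r} → AbelianPowerFree k (fin (u ++ r)) → AbelianPowerFree k (fin u)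
powerFree-prefix u {r} free x v (fin y) (fin refl) =
  free x v (fin (y ++ r)) (fin (trans (++-assoc x _ r) (cong (x ++_) (++-assoc (concat (tabulate v)) y r))))

powerFree-applyUpTo : ∀ {k w} → AbelianPowerFree k (inf w) → ∀ n → AbelianPowerFree k (fin (applyUpTo w n))
powerFree-applyUpTo {w = w} free n x v (fin y) (fin eq) =
  free x v (inf (y ++ω rest)) (inf λ m → begin
    w m                                        ≡⟨ applyUpTo-++ω-drop w n m ⟩
    (applyUpTo w n ++ω rest) m                 ≡⟨ cong (λ p → (p ++ω rest) m) eq ⟩
    ((x ++ vs ++ y) ++ω rest) m                ≡⟨ cong (λ p → (p ++ω rest) m) (++-assoc x vs y) ⟨
    (((x ++ vs) ++ y) ++ω rest) m              ≡⟨ ++ω-++ (x ++ vs) y rest m ⟩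
    ((x ++ vs) ++ω y ++ω rest) m               ≡⟨ ++ω-++ x vs (y ++ω rest) m ⟩
    (x ++ω vs ++ω y ++ω rest) m                ∎)
  where
  open ≡-Reasoning
  vs = concat (tabulate v)
  rest = w ∘ (n +_)

-- A power occurs within the finite prefix that stops exactly where it ends, hence the empty tail
-- `fin []`.
powerFree-inf : ∀ {k w} → (∀ n → AbelianPowerFree k (fin (applyUpTo w n))) → AbelianPowerFree k (inf w)
powerFree-inf {w = w} free x v y eq =
  free _ x v (fin []) (fin (trans (factor-of-applyUpTo eq) (cong (x ++_) (sym (++-identityʳ _)))))

φ-morphism-powerFree : AbelianPowerFreeMorphism 6 φ-morphism
φ-morphism-powerFree (fin refl) free = φ-powerFree free
φ-morphism-powerFree (inf {w} {w′} prefixes unbounded) free = powerFree-inf applyUpTo-free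
  where
  applyUpTo-free : ∀ m → AbelianPowerFree 6 (fin (applyUpTo w′ m))
  -- For large enough `n`, the prefix of `w′` of length `m` is a prefix of the image of a finite
  -- prefix of `w`.
  applyUpTo-free m with n , m≤ ← unbounded m
    with inf y , inf eq ← prefixes n
    with r , eq′ ← applyUpTo-≤ w′ m≤ =
    powerFree-prefix (applyUpTo w′ m)
      (subst (AbelianPowerFree 6 ∘ fin) (trans (sym (applyUpTo-++ω eq)) eq′)
        (φ-powerFree (powerFree-applyUpTo free n)))
-- This case is contradictory: `φ` never shortens a word, so the images of longer and longer
-- prefixes cannot stabilise. The chosen `n` exceeds `length v` and is past the point of
-- stabilisation.
φ-morphism-powerFree (inf→fin {w} {v} (m , stable)) free = ⊥-elim (<⇒≱ long short)
  where
  n = m + suc (length v)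
  long : length v < n
  long = m≤n+m (suc (length v)) m
  short : n ≤ length v
  short = subst₂ _≤_ (length-applyUpTo w n) (cong length (stable n (m≤m+n m _)))
                 (length≤length-φ (applyUpTo w n))

-- The fixed point as the limit of the iterates on `a`.

iterate : ℕ → List Letter
iterate zero = a ∷ []
iterate (suc n) = φ (iterate n)

-- The image of `a` begins with `a`, and applying `φ` preserves the prefix relation.
iterate-extends : ∀ n → ∃[ r ] (iterate (suc n) ≡ iterate n ++ r)
iterate-extends zero = _ , refl
iterate-extends (suc n) with r , eq ← iterate-extends n =
  φ r , trans (cong φ eq) (concatMap-++ image (iterate n) r)

iterate-prefix : ∀ {m n} → m ≤′ n → ∃[ r ] (iterate n ≡ iterate m ++ r)
iterate-prefix ≤′-refl = [] , sym (++-identityʳ _)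
iterate-prefix {m} (≤′-step {n} m≤n) with r , eq ← iterate-prefix m≤n | s , eq′ ← iterate-extends n =
  r ++ s , trans eq′ (trans (cong (_++ s) eq) (++-assoc (iterate m) r s))

n<length-iterate : ∀ n → n < length (iterate n)
n<length-iterate zero = s≤s z≤n
-- Writing `iterate n` as `a ∷ r` makes the growth strict: the leading `a` becomes six letters and
-- `r` does not shrink.
n<length-iterate (suc n) with r , eq ← iterate-prefix {0} {n} (≤⇒≤′ z≤n) =
  ≤-trans (s≤s (subst (λ u → n < length u) eq (n<length-iterate n)))
    (subst (λ u → length (a ∷ r) < length (φ u)) (sym eq)
      (s≤s (s≤s (≤-trans (length≤length-φ r) (m≤n+m _ 4)))))

-- The tail of a's is never reached, as n < length (iterate n).
Ω : ℕ → Letter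
Ω n = (iterate n ++ω λ _ → a) n

++ω-prefix : ∀ x {y w w′ n} → n < length x → ((x ++ y) ++ω w) n ≡ (x ++ω w′) n
++ω-prefix (c ∷ x) {n = zero} n< = refl
++ω-prefix (c ∷ x) {n = suc n} (s≤s n<) = ++ω-prefix x n<

-- `Ω` reads its letter `m` from iterate `m`. Of iterates `m` and `n` one is a prefix of the other
-- and both are longer than `m`, so they agree at that position.
applyUpTo-Ω : ∀ n → applyUpTo Ω (length (iterate n)) ≡ iterate n
applyUpTo-Ω n = applyUpTo-agree (iterate n) (λ _ → a) Ω agree
  where
  agree : ∀ m → m < length (iterate n) → (iterate n ++ω λ _ → a) m ≡ Ω m
  agree m m< with ≤-total m n
  ... | inj₁ m≤n with r , eq ← iterate-prefix (≤⇒≤′ m≤n) =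
    trans (cong (λ u → (u ++ω λ _ → a) m) eq) (++ω-prefix (iterate m) (n<length-iterate m))
  ... | inj₂ n≤m with r , eq ← iterate-prefix (≤⇒≤′ n≤m) =
    sym (trans (cong (λ u → (u ++ω λ _ → a) m) eq) (++ω-prefix (iterate n) m<))

iterate-applyUpTo : ∀ n → ∃[ r ] (iterate n ≡ applyUpTo Ω n ++ r)
iterate-applyUpTo n with r , eq ← applyUpTo-≤ Ω (≤-trans (n≤1+n n) (n<length-iterate n)) =
  r , trans (sym (applyUpTo-Ω n)) eq

Ω-fixed : FixedPoint φ-morphism Ω
Ω-fixed = inf prefixes λ m → m , subst (_≤ length (φ (applyUpTo Ω m))) (length-applyUpTo Ω m)
                                       (length≤length-φ (applyUpTo Ω m))
  where
  open ≡-Reasoning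
  prefixes : ∀ n → Prefix (φ (applyUpTo Ω n)) (inf Ω)
  -- `applyUpTo Ω n` is a prefix of `iterate n`, so its image is a prefix of `iterate (suc n)`,
  -- itself a prefix of `Ω`.
  prefixes n with r , eq ← iterate-applyUpTo n = inf (φ r ++ω rest) , inf λ m → begin
    Ω m                                            ≡⟨ applyUpTo-++ω-drop Ω N m ⟩
    (applyUpTo Ω N ++ω rest) m                     ≡⟨ cong (λ u → (u ++ω rest) m) (applyUpTo-Ω (suc n)) ⟩
    (φ (iterate n) ++ω rest) m                     ≡⟨ cong (λ u → (φ u ++ω rest) m) eq ⟩
    (φ (applyUpTo Ω n ++ r) ++ω rest) m
      ≡⟨ cong (λ u → (u ++ω rest) m) (concatMap-++ image (applyUpTo Ω n) r) ⟩
    ((φ (applyUpTo Ω n) ++ φ r) ++ω rest) m        ≡⟨ ++ω-++ (φ (applyUpTo Ω n)) (φ r) rest m ⟩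
    (φ (applyUpTo Ω n) ++ω φ r ++ω rest) m         ∎
    where
    N = length (iterate (suc n))
    rest = Ω ∘ (N +_)

-- Power-freeness and forbidden factors of the fixed point.

ψ-head : ∀ c u → ¬ ψ (c ∷ u) c ≡ 0
ψ-head a u ()
ψ-head b u ()

ψ≗0⇒[] : ∀ u → (∀ c → ψ u c ≡ 0) → u ≡ []
ψ≗0⇒[] [] eq = refl
ψ≗0⇒[] (c ∷ u) eq = ⊥-elim (ψ-head c u (eq c))

-- If the first block is empty, equal Parikh vectors empty them all; otherwise the second is
-- nonempty too and a single letter cannot hold both. Two blocks are needed, hence `2 + k`.
singleton-powerFree : ∀ {k} c → AbelianPowerFree (2 + k) (fin (c ∷ []))
singleton-powerFree c x v (fin y) (fin eq) ψ-eq i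
  with v 0F in eq₀ | v 1F in eq₁ | ψ-eq 0F 1F
... | []    | _     | _ = ψ≗0⇒[] (v i) λ e → trans (ψ-eq i 0F e) (cong (λ w → ψ w e) eq₀)
... | d ∷ u | []    | h = ⊥-elim (ψ-head d u (h d))
... | d ∷ u | e ∷ w | _ = ⊥-elim (too-long x u eq)
  where
  too-long : ∀ x u {c d e w} → ¬ c ∷ [] ≡ x ++ (d ∷ u ++ e ∷ w) ++ y
  too-long [] [] ()
  too-long [] (_ ∷ _) ()
  too-long (_ ∷ []) _ ()
  too-long (_ ∷ _ ∷ _) _ ()

iterate-powerFree : ∀ n → AbelianPowerFree 6 (fin (iterate n))
iterate-powerFree zero = singleton-powerFree a
iterate-powerFree (suc n) = φ-powerFree (iterate-powerFree n)

Ω-powerFree : AbelianPowerFree 6 (inf Ω)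
Ω-powerFree = powerFree-inf λ n → let r , eq = iterate-applyUpTo n in
  powerFree-prefix (applyUpTo Ω n) (subst (AbelianPowerFree 6 ∘ fin) eq (iterate-powerFree n))

-- The word is an abelian 6-power with every block equal to `a`.
no-aaaaaa : ¬ Factor (a ∷ a ∷ a ∷ a ∷ a ∷ a ∷ []) (inf Ω)
no-aaaaaa (x , y , eq) with () ← Ω-powerFree x (λ _ → a ∷ []) y eq (λ _ _ _ → refl) zero

no-bb : ¬ Factor (b ∷ b ∷ []) (inf Ω)
no-bb (x , y , eq) with r , eq′ ← iterate-applyUpTo (length (x ++ b ∷ b ∷ []))
  -- Passing to the next iterate places the occurrence in a word of the form `φ u`, where
  -- `no-bb-in-φ` applies.
  with s , eq″ ← iterate-prefix (≤⇒≤′ (n≤1+n (length (x ++ b ∷ b ∷ [])))) =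
  no-bb-in-φ (iterate n) x (r ++ s) (begin
    iterate (suc n)                   ≡⟨ eq″ ⟩
    iterate n ++ s                    ≡⟨ cong (_++ s) eq′ ⟩
    (applyUpTo Ω n ++ r) ++ s         ≡⟨ cong (λ u → (u ++ r) ++ s) (factor-of-applyUpTo eq) ⟩
    ((x ++ b ∷ b ∷ []) ++ r) ++ s     ≡⟨ ++-assoc (x ++ b ∷ b ∷ []) r s ⟩
    (x ++ b ∷ b ∷ []) ++ r ++ s       ≡⟨ ++-assoc x (b ∷ b ∷ []) (r ++ s) ⟩
    x ++ b ∷ b ∷ r ++ s               ∎)
  where
  open ≡-Reasoning
  n = length (x ++ b ∷ b ∷ [])

theorem2p19 : ∃[ h ] (AbelianPowerFreeMorphism 6 h ×
    ∃[ Ω ] (FixedPoint h Ω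
    × ¬ Factor (a ∷ a ∷ a ∷ a ∷ a ∷ a ∷ []) (inf Ω)
    × ¬ Factor (b ∷ b ∷ []) (inf Ω)
    × AbelianPowerFree 6 (inf Ω)))
theorem2p19 = φ-morphism , φ-morphism-powerFree , Ω , Ω-fixed , no-aaaaaa , no-bb , Ω-powerFree
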